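{- A graph $G=(V,E)$ obtained by vertex-pasting from partial cubes $G_1=(V_1,E_1)$ and $G_2=(V_2,E_2)$ is a partial cube.
   Context: Graphs are simple, undirected, nonempty, and not necessarily finite. For a set $X$, the hypercube $\mathcal H(X)$ is the graph whose vertices are the finite subsets of $X$, with $P,Q$ adjacent iff $|P\Delta Q|=1$. A graph is a partial cube if it can be isometrically embedded (i.e. by a map preserving shortest-path distances) into some $\mathcal H(X)$. Vertex-pasting: given connected graphs $G_1,G_2$ and vertices $a_1\in V_1$, $a_2\in V_2$, the graph obtained from $G_1$ and $G_2$ by vertex-pasting (along $a_1,a_2$) is the graph obtained from the disjoint union of $G_1$ and $G_2$ by identifying $a_1$ with $a_2$ (and making no other identifications). -}

module Defs where

open import Level using (Level; _⊔_) renaming (zero to 0ℓ; suc to lsuc)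
open import Data.Bool using (Bool; true; false; _xor_; _≟_)
open import Data.Bool.Properties using (xor-comm; xor-same)
open import Data.Empty using (⊥)
open import Data.List using (List; []; length; filter; _++_)
open import Data.List.Membership.Propositional using (_∈_)
open import Data.List.Membership.Propositional.Properties
  using (∈-filter⁺; ∈-filter⁻; ∈-++⁺ˡ; ∈-++⁺ʳ; ∈-++⁻)
open import Data.List.Membership.Propositional.Properties.WithK using (unique∧set⇒bag)
open import Data.List.Relation.Binary.BagAndSetEquality using (∼bag⇒↭)
open import Data.List.Relation.Binary.Permutation.Propositional.Properties using (↭-length)
open import Data.List.Relation.Unary.AllPairs using ([])
open import Data.List.Relation.Unary.Unique.Propositional using (Unique)
import Data.List.Relation.Unary.Unique.Propositional.Properties as Uniqueₚ
open import Data.Nat using (ℕ; zero; suc; _≤_)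
open import Data.Product using (Σ; _×_; _,_; proj₁; proj₂; ∃)
open import Data.Sum using (_⊎_; inj₁; inj₂)
open import Function using (_⇔_; mk⇔; Equivalence; Func; _⟨$⟩_; _∘_)
open import Function.Properties.Equivalence using () renaming (sym to ⇔-sym; trans to ⇔-trans)
open import Relation.Binary
  using (Rel; Setoid; Reflexive; Symmetric; Transitive; Irreflexive; _Respects₂_)
open import Relation.Binary.PropositionalEquality
  using (_≡_; refl; sym; trans; cong; cong₂)

private variable
  a c ℓ e c′ ℓ′ e′ : Level

-- Vertices form a setoid, so that identifying vertices needs no quotient type.
record Graph (c ℓ e : Level) : Set (lsuc (c ⊔ ℓ ⊔ e)) where
  field
    vertices   : Setoid c ℓ
  open Setoid vertices public
    using (_≈_) renaming (Carrier to V; refl to ≈-refl; sym to ≈-sym; trans to ≈-trans)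
  field
    Adj        : Rel V e
    Adj-resp-≈ : Adj Respects₂ _≈_
    Adj-sym    : Symmetric Adj
    Adj-irrefl : Irreflexive _≈_ Adj
    inhabitant : V

module _ (G : Graph c ℓ e) where
  open Graph G

  data Walk : V → V → ℕ → Set (c ⊔ ℓ ⊔ e) where
    nil  : ∀ {u v} → u ≈ v → Walk u v zero
    cons : ∀ {u v w n} → Adj u v → Walk v w n → Walk u w (suc n)

  -- The distance from u to v is n.  It is a relation because the distance is
  -- infinite (no n is related) when u and v are not joined by a walk.
  -- Minimising over walks or over paths is the same: a shortest walk is a path.
  Distance : V → V → ℕ → Set (c ⊔ ℓ ⊔ e)
  Distance u v n = Walk u v n × (∀ {m} → Walk u v m → n ≤ m)

IsIsometric : (G : Graph c ℓ e) (H : Graph c′ ℓ′ e′) →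
              Func (Graph.vertices G) (Graph.vertices H) →
              Set (c ⊔ ℓ ⊔ e ⊔ c′ ⊔ ℓ′ ⊔ e′)
IsIsometric G H f =
  ∀ u v n → Distance G u v n ⇔ Distance H (f ⟨$⟩ u) (f ⟨$⟩ v) n

-- A subset is its characteristic function; `elements` witnesses finiteness by
-- listing the members without repetition.
record FiniteSubset (X : Set a) : Set a where
  field
    member   : X → Bool
    elements : List X
    unique   : Unique elements
    correct  : ∀ {x} → x ∈ elements ⇔ (member x ≡ true)
open FiniteSubset

∣_∣ : {X : Set a} → FiniteSubset X → ℕ
∣ P ∣ = length (elements P)

_≐_ : {X : Set a} → Rel (FiniteSubset X) a
P ≐ Q = ∀ x → member P x ≡ member Q x

∅ : {X : Set a} → FiniteSubset X
∅ = record
  { member   = λ _ → false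
  ; elements = []
  ; unique   = []
  ; correct  = mk⇔ (λ ()) (λ ())
  }

module _ {X : Set a} where

  infixl 6 _∖ˡ_
  _∖ˡ_ : FiniteSubset X → FiniteSubset X → List X
  P ∖ˡ Q = filter (λ x → member Q x ≟ false) (elements P)

  ∈-∖ˡ⁺ : ∀ P Q {x} → member P x ≡ true → member Q x ≡ false → x ∈ P ∖ˡ Q
  ∈-∖ˡ⁺ P Q p q = ∈-filter⁺ _ (Equivalence.from (correct P) p) q

  ∈-∖ˡ⁻ : ∀ P Q {x} → x ∈ P ∖ˡ Q → member P x ≡ true × member Q x ≡ false
  ∈-∖ˡ⁻ P Q x∈ with x∈P , q ← ∈-filter⁻ (λ x → member Q x ≟ false) {xs = elements P} x∈ =
    Equivalence.to (correct P) x∈P , q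

  infixl 6 _Δ_
  _Δ_ : FiniteSubset X → FiniteSubset X → FiniteSubset X
  P Δ Q = record
    { member   = λ x → member P x xor member Q x
    ; elements = P ∖ˡ Q ++ Q ∖ˡ P
    ; unique   = Uniqueₚ.++⁺ (Uniqueₚ.filter⁺ _ (unique P)) (Uniqueₚ.filter⁺ _ (unique Q)) disjoint
    ; correct  = mk⇔ to from
    }
    where
    disjoint : ∀ {x} → x ∈ P ∖ˡ Q × x ∈ Q ∖ˡ P → ⊥
    disjoint (l , r)
      with () ← trans (sym (proj₁ (∈-∖ˡ⁻ P Q l))) (proj₂ (∈-∖ˡ⁻ Q P r))

    to : ∀ {x} → x ∈ P ∖ˡ Q ++ Q ∖ˡ P → (member P x xor member Q x) ≡ true
    to x∈ with ∈-++⁻ (P ∖ˡ Q) x∈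
    ... | inj₁ l with p , q ← ∈-∖ˡ⁻ P Q l = cong₂ _xor_ p q
    ... | inj₂ r with q , p ← ∈-∖ˡ⁻ Q P r = cong₂ _xor_ p q

    from : ∀ {x} → (member P x xor member Q x) ≡ true → x ∈ P ∖ˡ Q ++ Q ∖ˡ P
    from {x} eq with member P x in p | member Q x in q
    ... | true  | false = ∈-++⁺ˡ (∈-∖ˡ⁺ P Q p q)
    ... | false | true  = ∈-++⁺ʳ (P ∖ˡ Q) (∈-∖ˡ⁺ Q P q p)

  ∣∣-cong : ∀ (P Q : FiniteSubset X) → P ≐ Q → ∣ P ∣ ≡ ∣ Q ∣
  ∣∣-cong P Q P≐Q = ↭-length (∼bag⇒↭ (unique∧set⇒bag (unique P) (unique Q)
    (⇔-trans (correct P) (⇔-trans (mk⇔ (trans (sym (P≐Q _))) (trans (P≐Q _))) (⇔-sym (correct Q))))))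

hypercube : Set a → Graph a a 0ℓ
hypercube X = record
  { vertices   = record
    { Carrier       = FiniteSubset X
    ; _≈_           = _≐_
    ; isEquivalence = record
      { refl  = λ _ → refl
      ; sym   = λ p x → sym (p x)
      ; trans = λ p q x → trans (p x) (q x)
      }
    }
  ; Adj        = λ P Q → ∣ P Δ Q ∣ ≡ 1
  ; Adj-resp-≈ =
      (λ {P} {Q} {R} Q≐R → trans (∣∣-cong (P Δ R) (P Δ Q)
        (λ x → cong (member P x xor_) (sym (Q≐R x)))))
    , (λ {P} {Q} {R} Q≐R → trans (∣∣-cong (R Δ P) (Q Δ P)
        (λ x → cong (_xor member P x) (sym (Q≐R x)))))
  ; Adj-sym    = λ {P} {Q} → trans (∣∣-cong (Q Δ P) (P Δ Q)
        (λ x → xor-comm (member Q x) (member P x)))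
  ; Adj-irrefl = λ {P} {Q} P≐Q adj → 0≢1 (trans (sym (∣∣-cong (P Δ Q) ∅
        (λ x → trans (cong (_xor member Q x) (P≐Q x)) (xor-same (member Q x))))) adj)
  ; inhabitant = ∅
  }
  where
  0≢1 : 0 ≡ 1 → ⊥
  0≢1 ()

-- Since hypercubes are connected, the equivalence in IsIsometric makes every
-- partial cube connected.
IsPartialCube : (a : Level) → Graph c ℓ e → Set (c ⊔ ℓ ⊔ e ⊔ lsuc a)
IsPartialCube a G =
  Σ (Set a) λ X → ∃ λ f → IsIsometric G (hypercube X) f

module _ (G₁ : Graph c ℓ e) (G₂ : Graph c′ ℓ′ e′)
         (a₁ : Graph.V G₁) (a₂ : Graph.V G₂) where
  private
    module G₁ = Graph G₁
    module G₂ = Graph G₂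

  -- The least equivalence relation on the disjoint union that extends the two
  -- vertex equalities and relates inj₁ a₁ to inj₂ a₂.
  data PasteEq : Rel (G₁.V ⊎ G₂.V) (c ⊔ ℓ ⊔ c′ ⊔ ℓ′) where
    left   : ∀ {u v} → u G₁.≈ v → PasteEq (inj₁ u) (inj₁ v)
    right  : ∀ {u v} → u G₂.≈ v → PasteEq (inj₂ u) (inj₂ v)
    glue   : ∀ {u v} → u G₁.≈ a₁ → v G₂.≈ a₂ → PasteEq (inj₁ u) (inj₂ v)
    unglue : ∀ {u v} → v G₂.≈ a₂ → u G₁.≈ a₁ → PasteEq (inj₂ v) (inj₁ u)

  -- Two classes are adjacent iff they have representatives adjacent in G₁ or in G₂.
  data PasteAdj : Rel (G₁.V ⊎ G₂.V) (c ⊔ ℓ ⊔ e ⊔ c′ ⊔ ℓ′ ⊔ e′) where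
    left  : ∀ {p q u v} → PasteEq p (inj₁ u) → G₁.Adj u v → PasteEq (inj₁ v) q → PasteAdj p q
    right : ∀ {p q u v} → PasteEq p (inj₂ u) → G₂.Adj u v → PasteEq (inj₂ v) q → PasteAdj p q

  private
    ≈-refl : Reflexive PasteEq
    ≈-refl {inj₁ _} = left G₁.≈-refl
    ≈-refl {inj₂ _} = right G₂.≈-refl

    ≈-sym : Symmetric PasteEq
    ≈-sym (left p)     = left (G₁.≈-sym p)
    ≈-sym (right p)    = right (G₂.≈-sym p)
    ≈-sym (glue p q)   = unglue q p
    ≈-sym (unglue q p) = glue p q

    ≈-trans : Transitive PasteEq
    ≈-trans (left p)     (left q)     = left (G₁.≈-trans p q)
    ≈-trans (left p)     (glue q r)   = glue (G₁.≈-trans p q) r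
    ≈-trans (right p)    (right q)    = right (G₂.≈-trans p q)
    ≈-trans (right p)    (unglue q r) = unglue (G₂.≈-trans p q) r
    ≈-trans (glue p q)   (right r)    = glue p (G₂.≈-trans (G₂.≈-sym r) q)
    ≈-trans (glue p _)   (unglue _ q) = left (G₁.≈-trans p (G₁.≈-sym q))
    ≈-trans (unglue p q) (left r)     = unglue p (G₁.≈-trans (G₁.≈-sym r) q)
    ≈-trans (unglue p _) (glue _ q)   = right (G₂.≈-trans p (G₂.≈-sym q))

    left⁻ : ∀ {u v} → PasteEq (inj₁ u) (inj₁ v) → u G₁.≈ v
    left⁻ (left p) = p

    right⁻ : ∀ {u v} → PasteEq (inj₂ u) (inj₂ v) → u G₂.≈ v
    right⁻ (right p) = p

    adj-sym : Symmetric PasteAdj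
    adj-sym (left p uv q)  = left (≈-sym q) (G₁.Adj-sym uv) (≈-sym p)
    adj-sym (right p uv q) = right (≈-sym q) (G₂.Adj-sym uv) (≈-sym p)

    adj-respʳ : ∀ {p q r} → PasteEq q r → PasteAdj p q → PasteAdj p r
    adj-respʳ qr (left p uv q)  = left p uv (≈-trans q qr)
    adj-respʳ qr (right p uv q) = right p uv (≈-trans q qr)

    adj-irrefl : Irreflexive PasteEq PasteAdj
    adj-irrefl pq (left p uv q)  =
      G₁.Adj-irrefl (left⁻ (≈-trans (≈-sym p) (≈-trans pq (≈-sym q)))) uv
    adj-irrefl pq (right p uv q) =
      G₂.Adj-irrefl (right⁻ (≈-trans (≈-sym p) (≈-trans pq (≈-sym q)))) uv

  vertexPaste : Graph (c ⊔ c′) (c ⊔ ℓ ⊔ c′ ⊔ ℓ′) (c ⊔ ℓ ⊔ e ⊔ c′ ⊔ ℓ′ ⊔ e′)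
  vertexPaste = record
    { vertices   = record
      { Carrier       = G₁.V ⊎ G₂.V
      ; _≈_           = PasteEq
      ; isEquivalence = record { refl = ≈-refl ; sym = ≈-sym ; trans = ≈-trans }
      }
    ; Adj        = PasteAdj
    ; Adj-resp-≈ = adj-respʳ , (λ qr → adj-sym ∘ adj-respʳ qr ∘ adj-sym)
    ; Adj-sym    = adj-sym
    ; Adj-irrefl = adj-irrefl
    ; inhabitant = inj₁ a₁
    }

{-# OPTIONS --safe #-}
-- Mapping a vertex p of the pasted graph to f₁ (π₁ p) ⊕ f₂ (π₂ p), where πᵢ retracts the
-- pasted graph onto Gᵢ by collapsing the other part to aᵢ, gives a map into the hypercube
-- on X₁ ⊎ X₂ for which |F p Δ F q| = d₁(π₁ p, π₁ q) + d₂(π₂ p, π₂ q).  An edge changes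
-- only one of the two summands, so walks are at least that long; conversely shortest walks
-- of G₁ and G₂ joined at the glued vertex attain this length.
module Submission where

open import Defs
open import Level using (Level; _⊔_)
open import Data.Bool using (true; false; _xor_)
open import Data.Bool.Properties using (not-¬; xor-assoc; xor-identityʳ; xor-same)
open import Data.Empty using (⊥; ⊥-elim)
open import Data.List using ([]; _∷_; map; _++_)
open import Data.List.Membership.Propositional using (_∈_)
open import Data.List.Membership.Propositional.Properties
  using (∈-map⁺; ∈-map⁻; ∈-++⁺ˡ; ∈-++⁺ʳ; ∈-++⁻)
open import Data.List.Properties using (length-++; length-map; length-filter)
open import Data.List.Relation.Unary.All as All using ()
open import Data.List.Relation.Unary.AllPairs using ([]; _∷_)
open import Data.List.Relation.Unary.Any using (here; there)
import Data.List.Relation.Unary.Unique.Propositional.Properties as Uniqueₚ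
open import Data.Nat using (ℕ; zero; suc; _+_; _≤_)
open import Data.Nat.Properties
  using (≤-antisym; ≤-reflexive; ≤-trans; +-mono-≤; +-comm; +-identityʳ; suc-injective)
open import Data.Product using (_×_; _,_; proj₁; proj₂; ∃)
open import Data.Sum using (_⊎_; inj₁; inj₂; [_,_])
open import Data.Sum.Properties using (inj₁-injective; inj₂-injective)
open import Function using (id; const; _⇔_; mk⇔; Equivalence; Func; _⟨$⟩_)
open import Relation.Binary.PropositionalEquality
  using (_≡_; refl; sym; trans; cong; cong₂; subst; module ≡-Reasoning)
open import Relation.Nullary using (Dec; yes; no; does)

open FiniteSubset

private variable
  a b c ℓ e c′ ℓ′ e′ : Level

-- Walks and distances in an arbitrary graph.

module _ (G : Graph c ℓ e) where
  open Graph G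

  -- Lets walks be joined at endpoints that agree only up to `≈`, as at the glued vertex; the length
  -- does not change.
  walk-resp-≈ˡ : ∀ {u v w n} → u ≈ v → Walk G v w n → Walk G u w n
  walk-resp-≈ˡ u≈v (nil v≈w)   = nil (≈-trans u≈v v≈w)
  walk-resp-≈ˡ u≈v (cons vx p) = cons (proj₂ Adj-resp-≈ (≈-sym u≈v) vx) p

  walk-++ : ∀ {u v w m n} → Walk G u v m → Walk G v w n → Walk G u w (m + n)
  walk-++ (nil u≈v)   q = walk-resp-≈ˡ u≈v q
  walk-++ (cons ux p) q = cons ux (walk-++ p q)

  distance-unique : ∀ {u v m n} → Distance G u v m → Distance G u v n → m ≡ n
  distance-unique (p , p-min) (q , q-min) = ≤-antisym (p-min q) (q-min p)

walk-map : (G : Graph c ℓ e) (H : Graph c′ ℓ′ e′) (f : Graph.V G → Graph.V H) →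
           (∀ {u v} → Graph._≈_ G u v → Graph._≈_ H (f u) (f v)) →
           (∀ {u v} → Graph.Adj G u v → Graph.Adj H (f u) (f v)) →
           ∀ {u v n} → Walk G u v n → Walk H (f u) (f v) n
walk-map G H f f-≈ f-adj (nil u≈v)   = nil (f-≈ u≈v)
walk-map G H f f-≈ f-adj (cons ux p) = cons (f-adj ux) (walk-map G H f f-≈ f-adj p)

-- Sizes of symmetric differences and walks in the hypercube.

xor-telescope : ∀ p q r → (p xor q) xor (q xor r) ≡ p xor r
xor-telescope p q r = begin
  (p xor q) xor (q xor r)  ≡⟨ xor-assoc p q (q xor r) ⟩
  p xor (q xor (q xor r))  ≡⟨ cong (p xor_) (xor-assoc q q r) ⟨
  p xor ((q xor q) xor r)  ≡⟨ cong (λ z → p xor (z xor r)) (xor-same q) ⟩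
  p xor r                  ∎
  where open ≡-Reasoning

module _ {X : Set a} where

  ∣Δ∣-cong : ∀ (P P′ Q Q′ : FiniteSubset X) → P ≐ P′ → Q ≐ Q′ → ∣ P Δ Q ∣ ≡ ∣ P′ Δ Q′ ∣
  ∣Δ∣-cong P P′ Q Q′ P≐P′ Q≐Q′ =
    ∣∣-cong (P Δ Q) (P′ Δ Q′) λ x → cong₂ _xor_ (P≐P′ x) (Q≐Q′ x)

  ∣PΔP∣≡0 : ∀ (P : FiniteSubset X) → ∣ P Δ P ∣ ≡ 0
  ∣PΔP∣≡0 P = ∣∣-cong (P Δ P) ∅ λ x → xor-same (member P x)

  ∣PΔQ∣≤∣P∣+∣Q∣ : ∀ (P Q : FiniteSubset X) → ∣ P Δ Q ∣ ≤ ∣ P ∣ + ∣ Q ∣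
  ∣PΔQ∣≤∣P∣+∣Q∣ P Q = ≤-trans
    (≤-reflexive (length-++ (P ∖ˡ Q)))
    (+-mono-≤ (length-filter _ (elements P)) (length-filter _ (elements Q)))

  -- `Q` cancels in `(P Δ Q) Δ (Q Δ R)`, which therefore has the members of `P Δ R`.
  ∣Δ∣-triangle : ∀ (P Q R : FiniteSubset X) → ∣ P Δ R ∣ ≤ ∣ P Δ Q ∣ + ∣ Q Δ R ∣
  ∣Δ∣-triangle P Q R = ≤-trans
    (≤-reflexive (∣∣-cong (P Δ R) ((P Δ Q) Δ (Q Δ R)) λ x →
      sym (xor-telescope (member P x) (member Q x) (member R x))))
    (∣PΔQ∣≤∣P∣+∣Q∣ (P Δ Q) (Q Δ R))

  -- A point where the memberships differ would be listed in `elements (P Δ Q)`, but the length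
  -- equation forces that list to be `[]`.
  ∣PΔQ∣≡0⇒P≐Q : ∀ (P Q : FiniteSubset X) → ∣ P Δ Q ∣ ≡ 0 → P ≐ Q
  ∣PΔQ∣≡0⇒P≐Q P Q ∣D∣≡0 x with member P x | member Q x | elements (P Δ Q) | ∣D∣≡0
                              | Equivalence.from (correct (P Δ Q) {x})
  ... | true  | true  | _  | _ | _  = refl
  ... | false | false | _  | _ | _  = refl
  ... | true  | false | [] | _ | x∈ with () ← x∈ refl
  ... | false | true  | [] | _ | x∈ with () ← x∈ refl

  -- Membership is a Boolean function, which is why equality with `x` has to be decided.
  singleton : (x : X) → (∀ y → Dec (y ≡ x)) → FiniteSubset X
  singleton x _≟x = record
    { member   = λ y → does (y ≟x)
    ; elements = x ∷ []
    ; unique   = All.[] ∷ []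
    ; correct  = λ {y} → mk⇔ (to y) (from y)
    }
    where
    to : ∀ y → y ∈ x ∷ [] → does (y ≟x) ≡ true
    to y (here y≡x) with y ≟x
    ... | yes _  = refl
    ... | no y≢x = ⊥-elim (y≢x y≡x)

    from : ∀ y → does (y ≟x) ≡ true → y ∈ x ∷ []
    from y _ with yes y≡x ← y ≟x = here y≡x

  -- Equality on X need not be decidable, but equality with a listed element is: the
  -- position at which y is listed tells whether y is the head.
  remove-element : ∀ (D : FiniteSubset X) {n} → ∣ D ∣ ≡ suc n →
                   ∃ λ S → ∣ S ∣ ≡ 1 × ∣ S Δ D ∣ ≡ n
  remove-element D@record { elements = x ∷ xs ; unique = x∉xs ∷ xs! } ∣D∣≡1+n =
    -- `D′` has the membership function of `S Δ D` but lists just the tail `xs`, so its size is read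
    -- off from that of `D`.
    S , refl , trans (∣∣-cong (S Δ D) D′ λ _ → refl) (suc-injective ∣D∣≡1+n)
    where
    _≟x : ∀ y → Dec (y ≡ x)
    y ≟x with member D y in y∈D
    ... | false = no λ y≡x → not-¬ (Equivalence.to (correct D) (here y≡x)) y∈D
    ... | true with Equivalence.from (correct D) y∈D
    ...   | here y≡x   = yes y≡x
    ...   | there y∈xs = no λ y≡x → All.lookup x∉xs y∈xs (sym y≡x)

    S : FiniteSubset X
    S = singleton x _≟x

    D′ : FiniteSubset X
    D′ = record
      { member   = λ y → does (y ≟x) xor member D y
      ; elements = xs
      ; unique   = xs!
      ; correct  = λ {y} → mk⇔ (to y) (from y)
      }
      where
      to : ∀ y → y ∈ xs → does (y ≟x) xor member D y ≡ true
      to y y∈xs with y ≟x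
      ... | yes y≡x = ⊥-elim (All.lookup x∉xs y∈xs (sym y≡x))
      ... | no _    = Equivalence.to (correct D) (there y∈xs)

      from : ∀ y → does (y ≟x) xor member D y ≡ true → y ∈ xs
      from y eq with y ≟x
      from y eq | yes refl
        -- At `y = x` both memberships are `true`, so their xor is `false`.
        with () ← trans (sym (cong (true xor_) (Equivalence.to (correct D) (here refl)))) eq
      from y eq | no y≢x with Equivalence.from (correct D) eq
      ... | here y≡x   = ⊥-elim (y≢x y≡x)
      ... | there y∈xs = y∈xs

  -- Induction on the size of the difference: the first edge toggles one element of `P Δ Q`, leading
  -- from `P` to `S Δ P`. By associativity the difference that remains is `S Δ (P Δ Q)`, of size
  -- `n`.
  hypercube-walk : ∀ n (P Q : FiniteSubset X) → ∣ P Δ Q ∣ ≡ n → Walk (hypercube X) P Q n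
  hypercube-walk zero    P Q ∣D∣≡0   = nil (∣PΔQ∣≡0⇒P≐Q P Q ∣D∣≡0)
  hypercube-walk (suc n) P Q ∣D∣≡1+n
    with S , ∣S∣≡1 , ∣SΔD∣≡n ← remove-element (P Δ Q) ∣D∣≡1+n =
    cons {v = S Δ P}
      (trans (∣∣-cong (P Δ (S Δ P)) S λ x → xor-cancel (member P x) (member S x)) ∣S∣≡1)
      (hypercube-walk n (S Δ P) Q (trans
        (∣∣-cong ((S Δ P) Δ Q) (S Δ (P Δ Q)) λ x →
          xor-assoc (member S x) (member P x) (member Q x))
        ∣SΔD∣≡n))
    where
    xor-cancel : ∀ p s → p xor (s xor p) ≡ s
    xor-cancel true  true  = refl
    xor-cancel true  false = refl
    xor-cancel false s     = xor-identityʳ s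

-- Distances in the hypercube and isometric maps into it.

module _ (G : Graph c ℓ e) {X : Set a} (f : Func (Graph.vertices G) (Graph.vertices (hypercube X))) where
  open Graph G

  private
    d : V → V → ℕ
    d u v = ∣ (f ⟨$⟩ u) Δ (f ⟨$⟩ v) ∣

  -- The triangle inequality is summed along the walk. The bound on edges is kept abstract so that
  -- both the identity of a hypercube and the map on the pasted graph can be used for `f`.
  ∣Δ∣≤walk-length : (∀ {u v} → Adj u v → d u v ≤ 1) → ∀ {u v n} → Walk G u v n → d u v ≤ n
  ∣Δ∣≤walk-length adj {u} {v} (nil u≈v) = ≤-reflexive (trans
    (∣Δ∣-cong (f ⟨$⟩ u) (f ⟨$⟩ v) (f ⟨$⟩ v) (f ⟨$⟩ v) (Func.cong f u≈v) (λ _ → refl))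
    (∣PΔP∣≡0 (f ⟨$⟩ v)))
  ∣Δ∣≤walk-length adj {u} {v} (cons {v = w} uw p) = ≤-trans
    (∣Δ∣-triangle (f ⟨$⟩ u) (f ⟨$⟩ w) (f ⟨$⟩ v))
    (+-mono-≤ (adj uw) (∣Δ∣≤walk-length adj p))

hypercube-distance : {X : Set a} (P Q : FiniteSubset X) → Distance (hypercube X) P Q ∣ P Δ Q ∣
hypercube-distance P Q = hypercube-walk _ P Q refl ,
  -- Taking the identity for `f`, the edge bound is the definition of adjacency in the hypercube.
  ∣Δ∣≤walk-length (hypercube _) (record { to = id ; cong = id }) ≤-reflexive

module _ (G : Graph c ℓ e) {X : Set a} (f : Func (Graph.vertices G) (Graph.vertices (hypercube X))) where
  open Graph G

  -- Every pair in a hypercube has a distance, namely `∣ P Δ Q ∣`. As distances are unique, the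
  -- equivalence for all `n` reduces to this single value.
  isometric⇔distance : IsIsometric G (hypercube X) f ⇔
                       (∀ u v → Distance G u v ∣ (f ⟨$⟩ u) Δ (f ⟨$⟩ v) ∣)
  isometric⇔distance = mk⇔
    (λ iso u v → Equivalence.from (iso u v _) (hypercube-distance (f ⟨$⟩ u) (f ⟨$⟩ v)))
    (λ dist u v n → mk⇔
      (λ duv → subst (Distance (hypercube X) (f ⟨$⟩ u) (f ⟨$⟩ v))
        (distance-unique G (dist u v) duv) (hypercube-distance (f ⟨$⟩ u) (f ⟨$⟩ v)))
      (λ dfuv → subst (Distance G u v)
        (distance-unique (hypercube X) (hypercube-distance (f ⟨$⟩ u) (f ⟨$⟩ v)) dfuv) (dist u v)))

-- Disjoint unions of finite subsets.

module _ {X : Set a} {Y : Set b} where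

  infixr 5 _⊕_
  -- This pairing identifies the hypercube on `X ⊎ Y` with the Cartesian product of the two
  -- hypercubes.
  _⊕_ : FiniteSubset X → FiniteSubset Y → FiniteSubset (X ⊎ Y)
  P ⊕ Q = record
    { member   = [ member P , member Q ]
    ; elements = map inj₁ (elements P) ++ map inj₂ (elements Q)
    ; unique   = Uniqueₚ.++⁺ (Uniqueₚ.map⁺ inj₁-injective (unique P))
                             (Uniqueₚ.map⁺ inj₂-injective (unique Q)) disjoint
    ; correct  = λ {z} → mk⇔ to (from z)
    }
    where
    disjoint : ∀ {z} → z ∈ map inj₁ (elements P) × z ∈ map inj₂ (elements Q) → ⊥
    disjoint (l , r) with ∈-map⁻ inj₁ l | ∈-map⁻ inj₂ r
    ... | _ , _ , refl | _ , _ , ()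

    to : ∀ {z} → z ∈ map inj₁ (elements P) ++ map inj₂ (elements Q) → [ member P , member Q ] z ≡ true
    to z∈ with ∈-++⁻ (map inj₁ (elements P)) z∈
    ... | inj₁ l with _ , x∈ , refl ← ∈-map⁻ inj₁ l = Equivalence.to (correct P) x∈
    ... | inj₂ r with _ , y∈ , refl ← ∈-map⁻ inj₂ r = Equivalence.to (correct Q) y∈

    from : ∀ z → [ member P , member Q ] z ≡ true →
           z ∈ map inj₁ (elements P) ++ map inj₂ (elements Q)
    from (inj₁ x) eq = ∈-++⁺ˡ (∈-map⁺ inj₁ (Equivalence.from (correct P) eq))
    from (inj₂ y) eq = ∈-++⁺ʳ _ (∈-map⁺ inj₂ (Equivalence.from (correct Q) eq))

  ∣P⊕Q∣≡∣P∣+∣Q∣ : ∀ (P : FiniteSubset X) (Q : FiniteSubset Y) → ∣ P ⊕ Q ∣ ≡ ∣ P ∣ + ∣ Q ∣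
  ∣P⊕Q∣≡∣P∣+∣Q∣ P Q = trans (length-++ (map inj₁ (elements P)))
    (cong₂ _+_ (length-map inj₁ (elements P)) (length-map inj₂ (elements Q)))

  -- Symmetric difference acts separately on the two summands, so distances add as in a Cartesian
  -- product.
  ∣⊕Δ⊕∣ : ∀ (P P′ : FiniteSubset X) (Q Q′ : FiniteSubset Y) →
          ∣ (P ⊕ Q) Δ (P′ ⊕ Q′) ∣ ≡ ∣ P Δ P′ ∣ + ∣ Q Δ Q′ ∣
  ∣⊕Δ⊕∣ P P′ Q Q′ = trans
    (∣∣-cong ((P ⊕ Q) Δ (P′ ⊕ Q′)) ((P Δ P′) ⊕ (Q Δ Q′)) λ { (inj₁ _) → refl ; (inj₂ _) → refl })
    (∣P⊕Q∣≡∣P∣+∣Q∣ (P Δ P′) (Q Δ Q′))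

-- The pasted graph and its embedding.

module _ (G₁ : Graph c ℓ e) (G₂ : Graph c′ ℓ′ e′) (a₁ : Graph.V G₁) (a₂ : Graph.V G₂) where
  private
    module G₁ = Graph G₁
    module G₂ = Graph G₂
    G = vertexPaste G₁ G₂ a₁ a₂
    module G = Graph G

  walk-inj₁ : ∀ {u v n} → Walk G₁ u v n → Walk G (inj₁ u) (inj₁ v) n
  walk-inj₁ = walk-map G₁ G inj₁ left λ uv → left G.≈-refl uv G.≈-refl

  walk-inj₂ : ∀ {u v n} → Walk G₂ u v n → Walk G (inj₂ u) (inj₂ v) n
  walk-inj₂ = walk-map G₂ G inj₂ right λ uv → right G.≈-refl uv G.≈-refl

  π₁ : G.V → G₁.V
  π₁ = [ id , const a₁ ]

  π₂ : G.V → G₂.V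
  π₂ = [ const a₂ , id ]

  π₁-cong : ∀ {p q} → p G.≈ q → π₁ p G₁.≈ π₁ q
  π₁-cong (left u≈v)      = u≈v
  π₁-cong (right _)       = G₁.≈-refl
  π₁-cong (glue u≈a₁ _)   = u≈a₁
  π₁-cong (unglue _ u≈a₁) = G₁.≈-sym u≈a₁

  π₂-cong : ∀ {p q} → p G.≈ q → π₂ p G₂.≈ π₂ q
  π₂-cong (left _)        = G₂.≈-refl
  π₂-cong (right u≈v)     = u≈v
  π₂-cong (glue _ v≈a₂)   = G₂.≈-sym v≈a₂
  π₂-cong (unglue v≈a₂ _) = v≈a₂

  module _ {X₁ : Set a} {X₂ : Set b}
           (f₁ : Func G₁.vertices (Graph.vertices (hypercube X₁)))
           (f₂ : Func G₂.vertices (Graph.vertices (hypercube X₂))) where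

    pasteFunc : Func G.vertices (Graph.vertices (hypercube (X₁ ⊎ X₂)))
    pasteFunc = record
      { to   = λ p → (f₁ ⟨$⟩ π₁ p) ⊕ (f₂ ⟨$⟩ π₂ p)
      ; cong = λ { p≈q (inj₁ x) → Func.cong f₁ (π₁-cong p≈q) x
                 ; p≈q (inj₂ y) → Func.cong f₂ (π₂-cong p≈q) y }
      }

    private
      F = pasteFunc

      d₁ : G₁.V → G₁.V → ℕ
      d₁ u v = ∣ (f₁ ⟨$⟩ u) Δ (f₁ ⟨$⟩ v) ∣

      d₂ : G₂.V → G₂.V → ℕ
      d₂ u v = ∣ (f₂ ⟨$⟩ u) Δ (f₂ ⟨$⟩ v) ∣

    ∣FpΔFq∣ : ∀ p q → ∣ (F ⟨$⟩ p) Δ (F ⟨$⟩ q) ∣ ≡ d₁ (π₁ p) (π₁ q) + d₂ (π₂ p) (π₂ q)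
    ∣FpΔFq∣ p q = ∣⊕Δ⊕∣ (f₁ ⟨$⟩ π₁ p) (f₁ ⟨$⟩ π₁ q) (f₂ ⟨$⟩ π₂ p) (f₂ ⟨$⟩ π₂ q)

    -- `π₂` is constantly `a₂` on the part of `G₁`, so the second summand vanishes.
    ∣FpΔFq∣-left : ∀ u v → ∣ (F ⟨$⟩ inj₁ u) Δ (F ⟨$⟩ inj₁ v) ∣ ≡ d₁ u v
    ∣FpΔFq∣-left u v = trans (∣FpΔFq∣ (inj₁ u) (inj₁ v))
      (trans (cong (d₁ u v +_) (∣PΔP∣≡0 (f₂ ⟨$⟩ a₂))) (+-identityʳ _))

    ∣FpΔFq∣-right : ∀ u v → ∣ (F ⟨$⟩ inj₂ u) Δ (F ⟨$⟩ inj₂ v) ∣ ≡ d₂ u v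
    ∣FpΔFq∣-right u v = trans (∣FpΔFq∣ (inj₂ u) (inj₂ v))
      (cong (_+ d₂ u v) (∣PΔP∣≡0 (f₁ ⟨$⟩ a₁)))

    -- The two equalities point in the directions in which `PasteAdj` supplies them.
    ∣FpΔFq∣-resp-≈ : ∀ {p p′ q q′} → p G.≈ p′ → q′ G.≈ q →
                     ∣ (F ⟨$⟩ p) Δ (F ⟨$⟩ q) ∣ ≡ ∣ (F ⟨$⟩ p′) Δ (F ⟨$⟩ q′) ∣
    ∣FpΔFq∣-resp-≈ {p} {p′} {q} {q′} p≈p′ q′≈q =
      ∣Δ∣-cong (F ⟨$⟩ p) (F ⟨$⟩ p′) (F ⟨$⟩ q) (F ⟨$⟩ q′)
        (Func.cong F p≈p′) (Func.cong F (G.≈-sym {q′} {q} q′≈q))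

    paste-distance : (∀ u v → Distance G₁ u v (d₁ u v)) → (∀ u v → Distance G₂ u v (d₂ u v)) →
                     ∀ p q → Distance G p q ∣ (F ⟨$⟩ p) Δ (F ⟨$⟩ q) ∣
    paste-distance dist₁ dist₂ p q = walk p q , ∣Δ∣≤walk-length G F adj
      where
      adj : ∀ {p q} → G.Adj p q → ∣ (F ⟨$⟩ p) Δ (F ⟨$⟩ q) ∣ ≤ 1
      adj (left {u = u} {v} p≈u uv v≈q) = ≤-trans
        (≤-reflexive (trans (∣FpΔFq∣-resp-≈ p≈u v≈q) (∣FpΔFq∣-left u v)))
        -- Minimality of `d₁ u v`, tested on the walk consisting of the edge `uv` alone.
        (proj₂ (dist₁ u v) (cons uv (nil G₁.≈-refl)))
      adj (right {u = u} {v} p≈u uv v≈q) = ≤-trans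
        (≤-reflexive (trans (∣FpΔFq∣-resp-≈ p≈u v≈q) (∣FpΔFq∣-right u v)))
        (proj₂ (dist₂ u v) (cons uv (nil G₂.≈-refl)))

      walk₁ : ∀ u v → Walk G (inj₁ u) (inj₁ v) (d₁ u v)
      walk₁ u v = walk-inj₁ (proj₁ (dist₁ u v))

      walk₂ : ∀ u v → Walk G (inj₂ u) (inj₂ v) (d₂ u v)
      walk₂ u v = walk-inj₂ (proj₁ (dist₂ u v))

      walk : ∀ p q → Walk G p q ∣ (F ⟨$⟩ p) Δ (F ⟨$⟩ q) ∣
      walk (inj₁ u) (inj₁ v) = subst (Walk G _ _) (sym (∣FpΔFq∣-left u v)) (walk₁ u v)
      walk (inj₂ u) (inj₂ v) = subst (Walk G _ _) (sym (∣FpΔFq∣-right u v)) (walk₂ u v)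
      -- The walk passes through the glued vertex, where switching parts costs no edge. Its length
      -- matches because `π₁ (inj₂ v)` is `a₁` and `π₂ (inj₁ u)` is `a₂`.
      walk (inj₁ u) (inj₂ v) = subst (Walk G _ _) (sym (∣FpΔFq∣ (inj₁ u) (inj₂ v)))
        (walk-++ G (walk₁ u a₁)
          (walk-resp-≈ˡ G (glue G₁.≈-refl G₂.≈-refl) (walk₂ a₂ v)))
      walk (inj₂ u) (inj₁ v) = subst (Walk G _ _)
        -- This walk traverses `G₂` first, whereas the formula lists the `G₁` summand first.
        (trans (+-comm (d₂ u a₂) (d₁ a₁ v)) (sym (∣FpΔFq∣ (inj₂ u) (inj₁ v))))
        (walk-++ G (walk₂ u a₂)
          (walk-resp-≈ˡ G (unglue G₂.≈-refl G₁.≈-refl) (walk₁ a₁ v)))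

theorem7p1 : ∀ {c₁ ℓ₁ e₁ c₂ ℓ₂ e₂ x₁ x₂ : Level}
    (G₁ : Graph c₁ ℓ₁ e₁) (G₂ : Graph c₂ ℓ₂ e₂)
    (a₁ : Graph.V G₁) (a₂ : Graph.V G₂) →
    IsPartialCube x₁ G₁ → IsPartialCube x₂ G₂ →
    IsPartialCube (x₁ ⊔ x₂) (vertexPaste G₁ G₂ a₁ a₂)
theorem7p1 G₁ G₂ a₁ a₂ (X₁ , f₁ , iso₁) (X₂ , f₂ , iso₂) =
  (X₁ ⊎ X₂) , F , Equivalence.from (isometric⇔distance (vertexPaste G₁ G₂ a₁ a₂) F)
    (paste-distance G₁ G₂ a₁ a₂ f₁ f₂
      (Equivalence.to (isometric⇔distance G₁ f₁) iso₁)
      (Equivalence.to (isometric⇔distance G₂ f₂) iso₂))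
  where
  F = pasteFunc G₁ G₂ a₁ a₂ f₁ f₂
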